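{- Let $k$ be a positive integer, let $G$ be a $k$-connected graph, and let $W\subseteq V(G)$. Set $U=V(G)\setminus W$ and $w=|W|$. Suppose that $E(G[U])\neq\emptyset$ and $d_G(x)\ge \max\{k+1,w\}$ for every $x\in U$. Then $G[U]$ contains an edge that is $k$-removable in $G$, unless $w=k+1$ and $G[U]$ is a forest such that, for every leaf $u$ of $G[U]$, there exists $z_u\in W$ satisfying \[ N_G(u)=(W\setminus\{z_u\})\cup\{v_u\}, \] where $v_u$ is the unique neighbor of $u$ in $U$.
   Context: All graphs are finite, undirected and simple. A graph is $k$-connected in the usual sense: it has more than $k$ vertices and deleting any set of fewer than $k$ vertices leaves a connected graph. $G[U]$ is the subgraph of $G$ induced by $U$, $d_G(x)$ is the degree of $x$ in $G$, and $N_G(x)$ is the set of neighbors of $x$ in $G$. An edge $e$ of a $k$-connected graph $G$ is $k$-removable if $G-e$ (delete the edge $e$, keep all vertices) is $k$-connected. A leaf of $G[U]$ is a vertex of degree exactly one in $G[U]$. -}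

module Defs where

open import Data.Fin using (Fin; _≟_)
open import Data.Fin.Subset using (Subset; _∈_; _⊆_; _∩_; _∪_; _─_; _-_; ⁅_⁆; ∣_∣; Nonempty)
open import Data.Fin.Subset.Properties using (_∈?_; x∈p∩q⁺)
open import Data.List using (List; _∷_; _∷ʳ_; length)
open import Data.List.Relation.Unary.Linked using (Linked)
open import Data.List.Relation.Unary.Unique.Propositional using (Unique)
open import Data.Nat using (ℕ; _+_; _≤_; _<_)
open import Data.Product using (_×_; _,_; ∃-syntax)
open import Data.Sum using (_⊎_; inj₁; inj₂)
open import Data.Vec using (tabulate)
open import Level using (0ℓ)
open import Relation.Binary using (Rel; Symmetric; Irreflexive; Decidable)
open import Relation.Binary.Construct.Closure.ReflexiveTransitive using (Star)
open import Relation.Binary.PropositionalEquality using (_≡_)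
open import Relation.Nullary using (¬_; ¬?; _×-dec_; _⊎-dec_; does)

-- The vertex set is a subset of an ambient Fin n, so that a graph, its
-- induced subgraphs and its edge-deleted subgraphs share one type.
record Graph (n : ℕ) : Set₁ where
  field
    V      : Subset n
    Adj    : Rel (Fin n) 0ℓ
    adj?   : Decidable Adj
    sym    : Symmetric Adj
    irrefl : Irreflexive _≡_ Adj
    adj⇒∈V : ∀ {x y} → Adj x y → x ∈ V

open Graph public using (V; Adj)

module _ {n : ℕ} where

  N : Graph n → Fin n → Subset n
  N G x = tabulate λ y → does (Graph.adj? G x y)

  degree : Graph n → Fin n → ℕ
  degree G x = ∣ N G x ∣

  infix 8 _[_]

  _[_] : Graph n → Subset n → Graph n
  G [ U ] = record
    { V      = V G ∩ U
    ; Adj    = λ x y → Adj G x y × x ∈ U × y ∈ U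
    ; adj?   = λ x y → Graph.adj? G x y ×-dec (x ∈? U) ×-dec (y ∈? U)
    ; sym    = λ (xy , x∈U , y∈U) → Graph.sym G xy , y∈U , x∈U
    ; irrefl = λ x≡y (xy , _) → Graph.irrefl G x≡y xy
    ; adj⇒∈V = λ (xy , x∈U , _) → x∈p∩q⁺ (Graph.adj⇒∈V G xy , x∈U)
    }

  deleteVertices : Graph n → Subset n → Graph n
  deleteVertices G X = G [ V G ─ X ]

  -- The ordered pairs (x , y) and (y , x) encode the same edge, so both
  -- adjacencies are removed.
  SameEdge : (a b x y : Fin n) → Set
  SameEdge a b x y = (x ≡ a × y ≡ b) ⊎ (x ≡ b × y ≡ a)

  deleteEdge : Graph n → Fin n → Fin n → Graph n
  deleteEdge G a b = record
    { V      = V G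
    ; Adj    = λ x y → Adj G x y × ¬ SameEdge a b x y
    ; adj?   = λ x y → Graph.adj? G x y ×-dec
                 ¬? (((x ≟ a) ×-dec (y ≟ b)) ⊎-dec ((x ≟ b) ×-dec (y ≟ a)))
    ; sym    = λ (xy , ne) → Graph.sym G xy ,
                 λ { (inj₁ (p , q)) → ne (inj₂ (q , p))
                   ; (inj₂ (p , q)) → ne (inj₁ (q , p)) }
    ; irrefl = λ x≡y (xy , _) → Graph.irrefl G x≡y xy
    ; adj⇒∈V = λ (xy , _) → Graph.adj⇒∈V G xy
    }

  Connected : Graph n → Set
  Connected G = Nonempty (V G) × (∀ {x y} → x ∈ V G → y ∈ V G → Star (Adj G) x y)

  _-Connected_ : ℕ → Graph n → Set
  k -Connected G =
    k < ∣ V G ∣ × (∀ X → X ⊆ V G → ∣ X ∣ < k → Connected (deleteVertices G X))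

  Removable : ℕ → Graph n → Fin n → Fin n → Set
  Removable k G x y = Adj G x y × k -Connected (deleteEdge G x y)

  -- The cycle x , vs₁ , … , vsₘ , x with m ≥ 2, hence of length at least 3.
  IsCycle : Graph n → Fin n → List (Fin n) → Set
  IsCycle G x vs = 2 ≤ length vs × Unique (x ∷ vs) × Linked (Adj G) (x ∷ vs ∷ʳ x)

  Forest : Graph n → Set
  Forest G = ¬ (∃[ x ] ∃[ vs ] IsCycle G x vs)

  Leaf : Graph n → Fin n → Set
  Leaf G u = u ∈ V G × degree G u ≡ 1

  Exceptional : ℕ → Graph n → Subset n → Set
  Exceptional k G W =
    let U = V G ─ W in
    ∣ W ∣ ≡ k + 1 ×
    Forest (G [ U ]) ×
    (∀ u → Leaf (G [ U ]) u →
       ∃[ z ] ∃[ v ] (z ∈ W × N (G [ U ]) u ≡ ⁅ v ⁆ × N G u ≡ (W - z) ∪ ⁅ v ⁆))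

{-# OPTIONS --safe #-}
module Submission where

-- If the edge xy of G is not k-removable, V(G) splits into A ∋ x, B ∋ y and a
-- separator S with fewer than k vertices such that xy is the only A–B edge.
-- Suppose a has degree greater than k and neither of the edges ax and ab
-- (b ≠ x) is k-removable, with cuts (A, S, B) and (A′, S′, B′), a ∈ A ∩ A′.
-- Submodularity of the borders of the four corners yields a cut of ab whose
-- b-side, or a cut of ax whose x-side, is smaller than A.  So if no edge of G[U]
-- is k-removable, infinite descent shows that no nonempty Q ⊆ U induces a graph
-- of minimum degree at least 2; hence G[U] is a forest with a leaf.  For a leaf u
-- with neighbour v, take a cut (A, S, B) of uv.  Since u sees all of W but at
-- most one vertex, ∣W ∩ B∣ ≤ 1, and unless ∣W∣ = k + 1 = d(u) every vertex of
-- B ∩ U other than v has two neighbours in B ∩ U, and v has one.  Pruning the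
-- path that starts at v leaves a subset of minimum degree at least 2, a
-- contradiction.

open import Defs
open import Data.Empty using (⊥; ⊥-elim)
open import Data.Fin using (Fin; zero; suc; _≟_)
open import Data.Fin.Properties using (any?)
open import Data.Fin.Subset
  using (Subset; inside; outside; _∈_; _∉_; _⊆_; _∩_; _∪_; ∁; _─_; _-_; ⁅_⁆; ∣_∣)
open import Data.Fin.Subset.Properties
open import Data.List using (_∷_; []; _∷ʳ_; length)
open import Data.List.Membership.Propositional using () renaming (_∈_ to _∈ₗ_; _∉_ to _∉ₗ_)
open import Data.List.Relation.Unary.All as All using (_∷_)
open import Data.List.Relation.Unary.AllPairs using (_∷_)
open import Data.List.Relation.Unary.Any using (here; there)
open import Data.List.Relation.Unary.Linked using (Linked; _∷_)
open import Data.List.Relation.Unary.Unique.Propositional using (Unique)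
open import Data.Nat using (ℕ; zero; suc; _+_; _⊔_; _≤_; _<_; _≥_; z<s; s≤s; s≤s⁻¹; _≤?_)
open import Data.Nat.Induction using (<-wellFounded)
open import Data.Nat.Properties renaming (_≟_ to _≟ℕ_)
open import Data.Product using (_×_; _,_; ∃; ∃-syntax; proj₁; proj₂)
open import Data.Sum using (_⊎_; inj₁; inj₂; [_,_]′; swap)
open import Data.Vec using ([]; _∷_; here; there)
open import Data.Vec.Properties using (lookup∘tabulate; []=⇒lookup; lookup⇒[]=)
open import Function using (_∘_; case_of_)
open import Induction.WellFounded using (Acc; acc)
open import Level using (Level)
open import Relation.Binary.Construct.Closure.ReflexiveTransitive using (Star; ε; _◅_; _◅◅_)
open import Relation.Binary.PropositionalEquality using (_≡_; _≢_; refl; sym; trans; cong; subst)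
open import Relation.Nullary using (¬_; yes; no; ¬?; _×-dec_; _⊎-dec_; does)
open import Relation.Nullary.Decidable using (dec-true; decidable-stable)

private
  variable
    n : ℕ

-- Cardinalities of finite sets and neighbourhoods.

x∈p─q⇒x∉q : ∀ {i : Fin n} (p q : Subset n) → i ∈ p ─ q → i ∉ q
x∈p─q⇒x∉q (_ ∷ _) (inside ∷ _) () here
x∈p─q⇒x∉q (_ ∷ p) (_ ∷ q) (there i∈) (there i∈q) = x∈p─q⇒x∉q p q i∈ i∈q

∣p∪q∣+∣p∩q∣≡∣p∣+∣q∣ : ∀ (p q : Subset n) → ∣ p ∪ q ∣ + ∣ p ∩ q ∣ ≡ ∣ p ∣ + ∣ q ∣
∣p∪q∣+∣p∩q∣≡∣p∣+∣q∣ []            []            = refl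
∣p∪q∣+∣p∩q∣≡∣p∣+∣q∣ (inside ∷ p)  (inside ∷ q)  = cong suc
  (trans (+-suc _ _) (trans (cong suc (∣p∪q∣+∣p∩q∣≡∣p∣+∣q∣ p q)) (sym (+-suc _ _))))
∣p∪q∣+∣p∩q∣≡∣p∣+∣q∣ (inside ∷ p)  (outside ∷ q) = cong suc (∣p∪q∣+∣p∩q∣≡∣p∣+∣q∣ p q)
∣p∪q∣+∣p∩q∣≡∣p∣+∣q∣ (outside ∷ p) (inside ∷ q)  =
  trans (cong suc (∣p∪q∣+∣p∩q∣≡∣p∣+∣q∣ p q)) (sym (+-suc _ _))
∣p∪q∣+∣p∩q∣≡∣p∣+∣q∣ (outside ∷ p) (outside ∷ q) = ∣p∪q∣+∣p∩q∣≡∣p∣+∣q∣ p q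

-- Every element is counted on the left at most as often as on the right. Most size estimates about
-- cuts are instances of this.
∣p∣+∣q∣≤∣r∣+∣t∣ : ∀ (p q r t : Subset n) →
  (∀ {i} → i ∈ p → i ∈ r ⊎ i ∈ t) → (∀ {i} → i ∈ q → i ∈ r ⊎ i ∈ t) →
  (∀ {i} → i ∈ p → i ∈ q → i ∈ r × i ∈ t) →
  ∣ p ∣ + ∣ q ∣ ≤ ∣ r ∣ + ∣ t ∣
∣p∣+∣q∣≤∣r∣+∣t∣ p q r t p⊆ q⊆ ∩⊆ = begin
  ∣ p ∣ + ∣ q ∣          ≡⟨ ∣p∪q∣+∣p∩q∣≡∣p∣+∣q∣ p q ⟨
  ∣ p ∪ q ∣ + ∣ p ∩ q ∣  ≤⟨ +-mono-≤
    (p⊆q⇒∣p∣≤∣q∣ (λ i∈ → x∈p∪q⁺ ([ p⊆ , q⊆ ]′ (x∈p∪q⁻ p q i∈))))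
    (p⊆q⇒∣p∣≤∣q∣ (λ i∈ → let (i∈p , i∈q) = x∈p∩q⁻ p q i∈ in x∈p∩q⁺ (∩⊆ i∈p i∈q))) ⟩
  ∣ r ∪ t ∣ + ∣ r ∩ t ∣  ≡⟨ ∣p∪q∣+∣p∩q∣≡∣p∣+∣q∣ r t ⟩
  ∣ r ∣ + ∣ t ∣          ∎
  where open ≤-Reasoning

∣p∪q∣≤∣p∣+∣q∣ : ∀ (p q : Subset n) → ∣ p ∪ q ∣ ≤ ∣ p ∣ + ∣ q ∣
∣p∪q∣≤∣p∣+∣q∣ p q = ≤-trans (m≤m+n _ _) (≤-reflexive (∣p∪q∣+∣p∩q∣≡∣p∣+∣q∣ p q))

∣p∪⁅x⁆∣≤∣p∣+1 : ∀ (p : Subset n) i → ∣ p ∪ ⁅ i ⁆ ∣ ≤ ∣ p ∣ + 1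
∣p∪⁅x⁆∣≤∣p∣+1 p i = ≤-trans (∣p∪q∣≤∣p∣+∣q∣ p ⁅ i ⁆) (≤-reflexive (cong (∣ p ∣ +_) (∣⁅x⁆∣≡1 i)))

∣p∣≤1⇒≡ : ∀ {p : Subset n} {i j} → ∣ p ∣ ≤ 1 → i ∈ p → j ∈ p → i ≡ j
∣p∣≤1⇒≡ {p = p} {i} {j} ∣p∣≤1 i∈p j∈p with i ≟ j
... | yes i≡j = i≡j
... | no  i≢j = ⊥-elim (<-irrefl refl (begin-strict
  0          <⟨ z<s ⟩
  1          ≡⟨ ∣⁅x⁆∣≡1 i ⟨
  ∣ ⁅ i ⁆ ∣  ≤⟨ p⊆q⇒∣p∣≤∣q∣ (λ h → subst (_∈ p - j) (sym (x∈⁅y⁆⇒x≡y i h)) (x∈p∧x≢y⇒x∈p-y i∈p i≢j)) ⟩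
  ∣ p - j ∣  ≤⟨ s≤s⁻¹ (≤-trans (x∈p⇒∣p-x∣<∣p∣ j∈p) ∣p∣≤1) ⟩
  0          ∎))
  where open ≤-Reasoning

∣p∣≡1⇒p≡⁅x⁆ : ∀ (p : Subset n) → ∣ p ∣ ≡ 1 → ∃[ i ] p ≡ ⁅ i ⁆
∣p∣≡1⇒p≡⁅x⁆ {n} p ∣p∣≡1 with nonempty? p
... | no p-empty = ⊥-elim (0≢1+n
  (trans (sym (trans (cong ∣_∣ (Empty-unique p-empty)) (∣⊥∣≡0 n))) ∣p∣≡1))
... | yes (i , i∈p) = i , ⊆-antisym
  (λ j∈p → subst (_∈ ⁅ i ⁆) (∣p∣≤1⇒≡ (≤-reflexive ∣p∣≡1) i∈p j∈p) (x∈⁅x⁆ i))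
  (λ j∈ → subst (_∈ p) (sym (x∈⁅y⁆⇒x≡y i j∈)) i∈p)

module _ (G : Graph n) where

  ∈N⁺ : ∀ {x y} → Adj G x y → y ∈ N G x
  ∈N⁺ {x} {y} xy = lookup⇒[]= y _
    (trans (lookup∘tabulate _ y) (dec-true (Graph.adj? G x y) xy))

  ∈N⁻ : ∀ {x y} → y ∈ N G x → Adj G x y
  ∈N⁻ {x} {y} y∈
    with Graph.adj? G x y | trans (sym (lookup∘tabulate (does ∘ Graph.adj? G x) y)) ([]=⇒lookup y∈)
  ... | yes xy | _ = xy
  ... | no _   | ()

-- Finite search and reachability.

module _ {ℓ₁ ℓ₂ : Level} where

  -- Neither `P` nor `Q` has to be decidable: `Q` plays the role of positive evidence against `P`,
  -- so a failing universal statement yields a concrete cut.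
  ∀⊎∃-Fin : ∀ {P : Fin n → Set ℓ₁} {Q : Fin n → Set ℓ₂} →
            (∀ i → P i ⊎ Q i) → (∀ i → P i) ⊎ ∃ Q
  ∀⊎∃-Fin {zero}  f = inj₁ λ ()
  ∀⊎∃-Fin {suc n} f with f zero | ∀⊎∃-Fin (f ∘ suc)
  ... | inj₂ q | _             = inj₂ (zero , q)
  ... | inj₁ _ | inj₂ (i , q)  = inj₂ (suc i , q)
  ... | inj₁ p | inj₁ ps       = inj₁ λ { zero → p ; (suc i) → ps i }

  ∀⊎∃-Subset : ∀ {P : Subset n → Set ℓ₁} {Q : Subset n → Set ℓ₂} →
               (∀ X → P X ⊎ Q X) → (∀ X → P X) ⊎ ∃ Q
  ∀⊎∃-Subset {zero}  f with f []
  ... | inj₁ p = inj₁ λ { [] → p }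
  ... | inj₂ q = inj₂ ([] , q)
  ∀⊎∃-Subset {suc n} f with ∀⊎∃-Subset (f ∘ (inside ∷_)) | ∀⊎∃-Subset (f ∘ (outside ∷_))
  ... | inj₂ (X , q) | _            = inj₂ (_ , q)
  ... | inj₁ _       | inj₂ (X , q) = inj₂ (_ , q)
  ... | inj₁ ps      | inj₁ qs      = inj₁ λ { (inside ∷ X) → ps X ; (outside ∷ X) → qs X }

-- Starting from `p`, each edge leaving the current set adds its far end. The complement shrinks
-- each time, so the growth stops at a set closed under adjacency.
component : (H : Graph n) (p : Fin n) →
  ∃[ A ] (p ∈ A × (∀ {a} → a ∈ A → Star (Adj H) p a) × (∀ {a b} → a ∈ A → Adj H a b → b ∈ A))
component H p = grow ⁅ p ⁆ (x∈⁅x⁆ p)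
  (λ a∈ → subst (Star (Adj H) p) (sym (x∈⁅y⁆⇒x≡y p a∈)) ε) (<-wellFounded _)
  where
  grow : ∀ A → p ∈ A → (∀ {a} → a ∈ A → Star (Adj H) p a) → Acc _<_ ∣ ∁ A ∣ →
    ∃[ A ] (p ∈ A × (∀ {a} → a ∈ A → Star (Adj H) p a) × (∀ {a b} → a ∈ A → Adj H a b → b ∈ A))
  grow A p∈A reach (acc rec)
    with any? (λ a → any? (λ b → (a ∈? A) ×-dec (Graph.adj? H a b ×-dec ¬? (b ∈? A))))
  ... | no closed = A , p∈A , reach ,
    λ {a} {b} a∈A ab → decidable-stable (b ∈? A) λ b∉A → closed (a , b , a∈A , ab , b∉A)
  ... | yes (a , b , a∈A , ab , b∉A) = grow (A ∪ ⁅ b ⁆) (p⊆p∪q ⁅ b ⁆ p∈A)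
    (λ c∈ → [ reach
            , (λ c∈⁅b⁆ → subst (Star (Adj H) p) (sym (x∈⁅y⁆⇒x≡y b c∈⁅b⁆)) (reach a∈A ◅◅ ab ◅ ε)) ]′
            (x∈p∪q⁻ A ⁅ b ⁆ c∈))
    (rec (p⊂q⇒∣p∣<∣q∣ (p⊂q⇒∁p⊃∁q
      (p⊆p∪q ⁅ b ⁆ , b , q⊆p∪q A ⁅ b ⁆ (x∈⁅x⁆ b) , b∉A))))

-- Separators, and cuts as certificates of non-removability.

module KConnected {n k : ℕ} (G : Graph n) (G-connected : k -Connected G) where

  -- A walk that starts in `P` and avoids `L` never leaves `P`. With fewer than k vertices in `L`,
  -- connectivity would supply such a walk from `p` to `q`.
  separator-size : (P : Fin n → Set) (L : Subset n) →
    (∀ {r t} → P r → Adj G r t → P t ⊎ t ∈ L) →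
    ∀ {p q} → p ∈ V G → P p → p ∉ L → q ∈ V G → ¬ P q → q ∉ L → k ≤ ∣ L ∣
  separator-size P L closed {p} {q} p∈V Pp p∉L q∈V ¬Pq q∉L with k ≤? ∣ L ∣
  ... | yes k≤ = k≤
  ... | no  k≰ = ⊥-elim (¬Pq (walk Pp p⋯q))
    where
    -- Connectivity is stated for sets of vertices of `G` only, while `L` may contain other points
    -- of `Fin n`.
    X = L ∩ V G

    avoid : ∀ {i} → i ∈ V G → i ∉ L → i ∈ V G ∩ (V G ─ X)
    avoid i∈V i∉L = x∈p∩q⁺ (i∈V , x∈p∧x∉q⇒x∈p─q i∈V (i∉L ∘ p∩q⊆p L (V G)))

    p⋯q : Star (Adj (deleteVertices G X)) p q
    p⋯q = proj₂ (proj₂ G-connected X (p∩q⊆q L (V G))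
                  (≤-<-trans (∣p∩q∣≤∣p∣ L (V G)) (≰⇒> k≰)))
            (avoid p∈V p∉L) (avoid q∈V q∉L)

    walk : ∀ {r} → P r → Star (Adj (deleteVertices G X)) r q → P q
    walk Pr ε = Pr
    walk Pr ((rt , _ , t∈) ◅ rest) with closed Pr rt
    ... | inj₁ Pt  = walk Pt rest
    ... | inj₂ t∈L = ⊥-elim (x∈p─q⇒x∉q (V G) X t∈ (x∈p∩q⁺ (t∈L , p─q⊆p (V G) X t∈)))

  -- Certifies that G − xy is not k-connected: S separates x ∈ A from y ∈ B
  -- there.
  record Cut (x y : Fin n) : Set where
    field
      A S B : Subset n
      A⊆V   : A ⊆ V G
      B⊆V   : B ⊆ V G
      x∈A   : x ∈ A
      y∈B   : y ∈ B
      A∩S   : ∀ {i} → i ∈ A → i ∉ S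
      B∩S   : ∀ {i} → i ∈ B → i ∉ S
      A∩B   : ∀ {i} → i ∈ A → i ∉ B
      cover : ∀ {i} → i ∈ V G → i ∈ A ⊎ i ∈ S ⊎ i ∈ B
      ∣S∣<k : ∣ S ∣ < k
      cross : ∀ {p q} → p ∈ A → q ∈ B → Adj G p q → p ≡ x × q ≡ y

  open Cut

  flip : ∀ {x y} → Cut x y → Cut y x
  flip c = record
    { A = B c ; S = S c ; B = A c ; A⊆V = B⊆V c ; B⊆V = A⊆V c ; x∈A = y∈B c ; y∈B = x∈A c
    ; A∩S = B∩S c ; B∩S = A∩S c ; A∩B = λ i∈B i∈A → A∩B c i∈A i∈B
    ; cover = λ i∈V → [ inj₂ ∘ inj₂ , [ inj₂ ∘ inj₁ , inj₁ ]′ ]′ (cover c i∈V)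
    ; ∣S∣<k = ∣S∣<k c
    ; cross = λ p∈ q∈ pq → let (q≡x , p≡y) = cross c q∈ p∈ (Graph.sym G pq) in p≡y , q≡x
    }

  -- With everything outside A and S taken as B, only the edges leaving A have to be inspected.
  mkCut : ∀ {x y} (A S : Subset n) → A ⊆ V G → x ∈ A → y ∈ V G → y ∉ A → y ∉ S →
    (∀ {i} → i ∈ A → i ∉ S) → ∣ S ∣ < k →
    (∀ {p q} → p ∈ A → Adj G p q → q ∈ A ⊎ q ∈ S ⊎ (p ≡ x × q ≡ y)) → Cut x y
  mkCut A S A⊆V x∈A y∈V y∉A y∉S A∩S ∣S∣<k leave = record
    { A = A ; S = S ; B = (V G ─ A) ─ S
    ; A⊆V = A⊆V ; B⊆V = p─q⊆p (V G) A ∘ p─q⊆p (V G ─ A) S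
    ; x∈A = x∈A
    ; y∈B = x∈p∧x∉q⇒x∈p─q (x∈p∧x∉q⇒x∈p─q y∈V y∉A) y∉S
    ; A∩S = A∩S
    ; B∩S = x∈p─q⇒x∉q (V G ─ A) S
    ; A∩B = λ i∈A i∈B → ∉A i∈B i∈A
    ; cover = λ {i} i∈V → case i ∈? A of λ where
        (yes i∈A) → inj₁ i∈A
        (no  i∉A) → case i ∈? S of λ where
          (yes i∈S) → inj₂ (inj₁ i∈S)
          (no  i∉S) → inj₂ (inj₂ (x∈p∧x∉q⇒x∈p─q (x∈p∧x∉q⇒x∈p─q i∈V i∉A) i∉S))
    ; ∣S∣<k = ∣S∣<k
    ; cross = λ p∈A q∈B pq → case leave p∈A pq of λ where
        (inj₁ q∈A)        → ⊥-elim (∉A q∈B q∈A)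
        (inj₂ (inj₁ q∈S)) → ⊥-elim (x∈p─q⇒x∉q (V G ─ A) S q∈B q∈S)
        (inj₂ (inj₂ eqs)) → eqs
    }
    where
    ∉A : ∀ {i} → i ∈ (V G ─ A) ─ S → i ∉ A
    ∉A = x∈p─q⇒x∉q (V G) A ∘ p─q⊆p (V G ─ A) S

  -- The component of `p` in G - xy - X either contains `q` or, with X as separator, is one side of
  -- a cut of xy.
  link⊎cut : ∀ {x y} → Adj G x y → ∀ X → ∣ X ∣ < k → ∀ p q →
    let H = deleteVertices (deleteEdge G x y) X in
    (p ∈ V H → q ∈ V H → Star (Adj H) p q) ⊎ Cut x y
  link⊎cut {x} {y} xy X <k = link
    where
    H = deleteVertices (deleteEdge G x y) X

    ∈H⁻ : ∀ {i} → i ∈ V H → i ∈ V G × i ∉ X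
    ∈H⁻ i∈ = let (i∈V , i∈V─X) = x∈p∩q⁻ (V G) (V G ─ X) i∈ in i∈V , x∈p─q⇒x∉q (V G) X i∈V─X

    link : ∀ p q → (p ∈ V H → q ∈ V H → Star (Adj H) p q) ⊎ Cut x y
    link p q with p ∈? V H | q ∈? V H
    ... | no p∉ | _ = inj₁ λ p∈ → ⊥-elim (p∉ p∈)
    ... | _ | no q∉ = inj₁ λ _ q∈ → ⊥-elim (q∉ q∈)
    ... | yes p∈ | yes q∈ with component H p
    ... | A , p∈A , reach , closed with q ∈? A
    ... | yes q∈A = inj₁ λ _ _ → reach q∈A
    ... | no  q∉A = inj₂ cut
      where
      A′ = A ∩ V H

      A′⊆V : A′ ⊆ V G
      A′⊆V = proj₁ ∘ ∈H⁻ ∘ p∩q⊆q A (V H)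

      A′∩X : ∀ {i} → i ∈ A′ → i ∉ X
      A′∩X = proj₂ ∘ ∈H⁻ ∘ p∩q⊆q A (V H)

      leave : ∀ {r t} → r ∈ A′ → Adj G r t → t ∈ A′ ⊎ t ∈ X ⊎ SameEdge x y r t
      leave {r} {t} r∈ rt with t ∈? X
      ... | yes t∈X = inj₂ (inj₁ t∈X)
      ... | no  t∉X with ((r ≟ x) ×-dec (t ≟ y)) ⊎-dec ((r ≟ y) ×-dec (t ≟ x))
      ... | yes same = inj₂ (inj₂ same)
      ... | no  diff = inj₁ (x∈p∩q⁺ (closed (p∩q⊆p A (V H) r∈) rt-H
                                   , Graph.adj⇒∈V H (Graph.sym H rt-H)))
        where
        rt-H : Adj H r t
        rt-H = (rt , diff) , x∈p∧x∉q⇒x∈p─q (A′⊆V r∈) (A′∩X r∈)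
                           , x∈p∧x∉q⇒x∈p─q (Graph.adj⇒∈V G (Graph.sym G rt)) t∉X

      -- If xy did not lead out of the component, X would separate `p` from `q` already in `G`, with
      -- fewer than k vertices.
      no-closed : (∀ {r t} → r ∈ A′ → Adj G r t → t ∈ A′ ⊎ t ∈ X) → ⊥
      no-closed closed′ = <⇒≱ <k (separator-size (_∈ A′) X closed′
        (proj₁ (∈H⁻ p∈)) (x∈p∩q⁺ (p∈A , p∈)) (proj₂ (∈H⁻ p∈))
        (proj₁ (∈H⁻ q∈)) (q∉A ∘ p∩q⊆p A (V H)) (proj₂ (∈H⁻ q∈)))

      -- Stated for a renamed edge uv, since either end of xy may be the one in the component.
      cut-at : ∀ {u v} → Adj G u v → (∀ {r t} → SameEdge x y r t → SameEdge u v r t) →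
               u ∈ A′ → Cut u v
      cut-at {u} {v} uv same u∈ with (v ∈? A′) ⊎-dec (v ∈? X)
      ... | yes v∈ = ⊥-elim (no-closed λ r∈ rt → case leave r∈ rt of λ where
              (inj₁ t∈)        → inj₁ t∈
              (inj₂ (inj₁ t∈)) → inj₂ t∈
              (inj₂ (inj₂ e))  → case same e of λ where
                (inj₁ (_ , refl)) → v∈
                (inj₂ (_ , refl)) → inj₁ u∈)
      ... | no v∉ = mkCut A′ X A′⊆V u∈ (Graph.adj⇒∈V G (Graph.sym G uv))
              (v∉ ∘ inj₁) (v∉ ∘ inj₂) A′∩X <k
              λ r∈ rt → case leave r∈ rt of λ where
                (inj₁ t∈)        → inj₁ t∈
                (inj₂ (inj₁ t∈)) → inj₂ (inj₁ t∈)
                (inj₂ (inj₂ e))  → case same e of λ where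
                  (inj₁ eqs)        → inj₂ (inj₂ eqs)
                  (inj₂ (_ , refl)) → inj₁ u∈

      cut : Cut x y
      cut with x ∈? A′ | y ∈? A′
      ... | yes x∈ | _ = cut-at xy (λ e → e) x∈
      ... | _ | yes y∈ = flip (cut-at (Graph.sym G xy) swap y∈)
      ... | no x∉ | no y∉ = ⊥-elim (no-closed λ r∈ rt → case leave r∈ rt of λ where
              (inj₁ t∈)                       → inj₁ t∈
              (inj₂ (inj₁ t∈))                → inj₂ t∈
              (inj₂ (inj₂ (inj₁ (refl , _)))) → ⊥-elim (x∉ r∈)
              (inj₂ (inj₂ (inj₂ (refl , _)))) → ⊥-elim (y∉ r∈))

  removable⊎cut : ∀ {x y} → Adj G x y → Removable k G x y ⊎ Cut x y
  removable⊎cut {x} {y} xy =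
    [ (λ connected → inj₁ (xy , proj₁ G-connected , connected)) , inj₂ ∘ proj₂ ]′
      (∀⊎∃-Subset separate)
    where
    separate : ∀ X →
      (X ⊆ V G → ∣ X ∣ < k → Connected (deleteVertices (deleteEdge G x y) X)) ⊎ Cut x y
    separate X with ∣ X ∣ <? k
    ... | no  ≮k = inj₁ λ _ <k → ⊥-elim (≮k <k)
    ... | yes <k with ∀⊎∃-Fin (λ p → ∀⊎∃-Fin (link⊎cut xy X <k p))
    ...   | inj₁ links         = inj₁ λ X⊆ _ → proj₁ (proj₂ G-connected X X⊆ <k) , links _ _
    ...   | inj₂ (_ , _ , cut) = inj₂ cut

  -- Corners of two cuts and their borders.

  border : ∀ {x y z w} → Cut x y → Cut z w → Subset n
  -- The union of S′ ∩ A, S′ ∩ S and S ∩ A′, which is the border of the corner A ∩ A′. The other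
  -- three corners arise by flipping `c` or `c′`.
  border c c′ = (S c′ ∩ (A c ∪ S c)) ∪ (S c ∩ A c′)

  module _ {x y z w} (c : Cut x y) (c′ : Cut z w) where

    border⁻ : ∀ {i} → i ∈ border c c′ → (i ∈ S c′ × (i ∈ A c ⊎ i ∈ S c)) ⊎ (i ∈ S c × i ∈ A c′)
    border⁻ i∈ with x∈p∪q⁻ (S c′ ∩ (A c ∪ S c)) (S c ∩ A c′) i∈
    ... | inj₂ i∈∩ = inj₂ (x∈p∩q⁻ (S c) (A c′) i∈∩)
    ... | inj₁ i∈∩ = let (i∈S′ , i∈∪) = x∈p∩q⁻ (S c′) (A c ∪ S c) i∈∩
                     in inj₁ (i∈S′ , x∈p∪q⁻ (A c) (S c) i∈∪)

    border⁺ : ∀ {i} → (i ∈ S c′ × (i ∈ A c ⊎ i ∈ S c)) ⊎ (i ∈ S c × i ∈ A c′) → i ∈ border c c′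
    border⁺ (inj₁ (i∈S′ , i∈∪)) = x∈p∪q⁺ (inj₁ (x∈p∩q⁺ (i∈S′ , x∈p∪q⁺ i∈∪)))
    border⁺ (inj₂ i∈∩)          = x∈p∪q⁺ (inj₂ (x∈p∩q⁺ i∈∩))

    border∩B : ∀ {i} → i ∈ B c → i ∉ border c c′
    border∩B i∈B i∈ with border⁻ i∈
    ... | inj₁ (_ , inj₁ i∈A) = A∩B c i∈A i∈B
    ... | inj₁ (_ , inj₂ i∈S) = B∩S c i∈B i∈S
    ... | inj₂ (i∈S , _)      = B∩S c i∈B i∈S

    border∩B′ : ∀ {i} → i ∈ B c′ → i ∉ border c c′
    border∩B′ i∈B′ i∈ with border⁻ i∈
    ... | inj₁ (i∈S′ , _) = B∩S c′ i∈B′ i∈S′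
    ... | inj₂ (_ , i∈A′) = A∩B c′ i∈A′ i∈B′

    border∩corner : ∀ {i} → i ∈ A c → i ∈ A c′ → i ∉ border c c′
    border∩corner i∈A i∈A′ i∈ with border⁻ i∈
    ... | inj₁ (i∈S′ , _) = A∩S c′ i∈A′ i∈S′
    ... | inj₂ (i∈S , _)  = A∩S c i∈A i∈S

    leave-corner : ∀ {r t} → r ∈ A c → r ∈ A c′ → Adj G r t →
      (t ∈ A c × t ∈ A c′) ⊎ t ∈ border c c′ ⊎ (r ≡ x × t ≡ y) ⊎ (r ≡ z × t ≡ w)
    leave-corner r∈A r∈A′ rt
      with cover c (Graph.adj⇒∈V G (Graph.sym G rt)) | cover c′ (Graph.adj⇒∈V G (Graph.sym G rt))
    ... | inj₂ (inj₂ t∈B) | _                 = inj₂ (inj₂ (inj₁ (cross c r∈A t∈B rt)))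
    ... | _               | inj₂ (inj₂ t∈B′)  = inj₂ (inj₂ (inj₂ (cross c′ r∈A′ t∈B′ rt)))
    ... | inj₁ t∈A        | inj₁ t∈A′         = inj₁ (t∈A , t∈A′)
    ... | inj₁ t∈A        | inj₂ (inj₁ t∈S′)  = inj₂ (inj₁ (border⁺ (inj₁ (t∈S′ , inj₁ t∈A))))
    ... | inj₂ (inj₁ t∈S) | inj₁ t∈A′         = inj₂ (inj₁ (border⁺ (inj₂ (t∈S , t∈A′))))
    ... | inj₂ (inj₁ t∈S) | inj₂ (inj₁ t∈S′)  = inj₂ (inj₁ (border⁺ (inj₁ (t∈S′ , inj₂ t∈S))))

  -- The border of A ∩ A′ avoids B and B′, that of B ∩ B′ avoids A and A′. A vertex in both
  -- therefore lies in S ∩ S′ and is counted twice on the right as well.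
  ∣border∣-submodular : ∀ {x y z w} (c : Cut x y) (c′ : Cut z w) →
    ∣ border c c′ ∣ + ∣ border (flip c) (flip c′) ∣ ≤ ∣ S c ∣ + ∣ S c′ ∣
  ∣border∣-submodular c c′ = ∣p∣+∣q∣≤∣r∣+∣t∣ (border c c′) (border (flip c) (flip c′)) (S c) (S c′)
    (half c c′) (half (flip c) (flip c′)) both
    where
    half : ∀ {x y z w} (c : Cut x y) (c′ : Cut z w) {i} → i ∈ border c c′ → i ∈ S c ⊎ i ∈ S c′
    half c c′ i∈ with border⁻ c c′ i∈
    ... | inj₁ (i∈S′ , _) = inj₂ i∈S′
    ... | inj₂ (i∈S , _)  = inj₁ i∈S

    both : ∀ {i} → i ∈ border c c′ → i ∈ border (flip c) (flip c′) → i ∈ S c × i ∈ S c′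
    both i∈ i∈′ with border⁻ c c′ i∈ | border⁻ (flip c) (flip c′) i∈′
    ... | inj₁ (_ , inj₁ i∈A)    | _ = ⊥-elim (border∩B (flip c) (flip c′) i∈A i∈′)
    ... | inj₁ (i∈S′ , inj₂ i∈S) | _ = i∈S , i∈S′
    ... | inj₂ (_ , i∈A′)        | _ = ⊥-elim (border∩B′ (flip c) (flip c′) i∈A′ i∈′)

  -- Two cuts at a common vertex: finding a smaller side.

  module Descent {a x b} (c : Cut a x) (c′ : Cut a b) (b≢x : b ≢ x)
    (ax : Adj G a x) (ab : Adj G a b) (k<deg : k + 1 ≤ degree G a) where

    a≢x : a ≢ x
    a≢x refl = A∩B c (x∈A c) (y∈B c)

    a≢b : a ≢ b
    a≢b refl = A∩B c′ (x∈A c′) (y∈B c′)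

    x∉B′ : x ∉ B c′
    x∉B′ x∈B′ = b≢x (sym (proj₂ (cross c′ (x∈A c′) x∈B′ ax)))

    b∉B : b ∉ B c
    b∉B b∈B = b≢x (proj₂ (cross c (x∈A c) b∈B ab))

    a∈V : a ∈ V G
    a∈V = A⊆V c (x∈A c)

    ∉border∪⁅⁆ : ∀ (L : Subset n) {i} → i ∉ L → i ≢ a → i ∉ L ∪ ⁅ a ⁆
    ∉border∪⁅⁆ L i∉L i≢a = [ i∉L , i≢a ∘ x∈⁅y⁆⇒x≡y a ]′ ∘ x∈p∪q⁻ L ⁅ a ⁆

    -- If the corner A ∩ A′ has a vertex besides `a`, the border together with `a` separates it from
    -- `x`. Otherwise all neighbours of `a` lie in the border or are `x` or `b`, and there are at
    -- least k + 1 of them.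
    k≤∣border-AA′∣+1 : k ≤ ∣ border c c′ ∣ + 1
    k≤∣border-AA′∣+1 with any? (λ r → (r ∈? A c) ×-dec ((r ∈? A c′) ×-dec ¬? (r ≟ a)))
    ... | yes (r , r∈A , r∈A′ , r≢a) = ≤-trans
      (separator-size (λ i → (i ∈ A c × i ∈ A c′) × i ≢ a) (L ∪ ⁅ a ⁆) closed
        (A⊆V c r∈A) ((r∈A , r∈A′) , r≢a) (∉border∪⁅⁆ L (border∩corner c c′ r∈A r∈A′) r≢a)
        (B⊆V c (y∈B c)) (λ ((x∈A , _) , _) → A∩B c x∈A (y∈B c))
        (∉border∪⁅⁆ L (border∩B c c′ (y∈B c)) (a≢x ∘ sym)))
      (∣p∪⁅x⁆∣≤∣p∣+1 L a)
      where
      L = border c c′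
      closed : ∀ {r t} → (r ∈ A c × r ∈ A c′) × r ≢ a → Adj G r t →
               ((t ∈ A c × t ∈ A c′) × t ≢ a) ⊎ t ∈ L ∪ ⁅ a ⁆
      closed {t = t} ((r∈A , r∈A′) , r≢a) rt with leave-corner c c′ r∈A r∈A′ rt
      ... | inj₂ (inj₁ t∈L) = inj₂ (p⊆p∪q ⁅ a ⁆ t∈L)
      ... | inj₂ (inj₂ (inj₁ (r≡a , _))) = ⊥-elim (r≢a r≡a)
      ... | inj₂ (inj₂ (inj₂ (r≡a , _))) = ⊥-elim (r≢a r≡a)
      ... | inj₁ t∈ with t ≟ a
      ... | yes refl = inj₂ (q⊆p∪q L ⁅ a ⁆ (x∈⁅x⁆ a))
      ... | no  t≢a  = inj₁ (t∈ , t≢a)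
    ... | no corner≡⁅a⁆ = +-cancelʳ-≤ 1 _ _ (begin
      k + 1                        ≤⟨ k<deg ⟩
      degree G a                   ≤⟨ p⊆q⇒∣p∣≤∣q∣ (N⊆ ∘ ∈N⁻ G) ⟩
      ∣ (L ∪ ⁅ x ⁆) ∪ ⁅ b ⁆ ∣      ≤⟨ ∣p∪⁅x⁆∣≤∣p∣+1 (L ∪ ⁅ x ⁆) b ⟩
      ∣ L ∪ ⁅ x ⁆ ∣ + 1            ≤⟨ +-monoˡ-≤ 1 (∣p∪⁅x⁆∣≤∣p∣+1 L x) ⟩
      ∣ L ∣ + 1 + 1                ∎)
      where
      open ≤-Reasoning
      L = border c c′
      N⊆ : ∀ {t} → Adj G a t → t ∈ (L ∪ ⁅ x ⁆) ∪ ⁅ b ⁆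
      N⊆ {t} at with leave-corner c c′ (x∈A c) (x∈A c′) at
      ... | inj₁ (t∈A , t∈A′) = ⊥-elim (corner≡⁅a⁆
                                  (t , t∈A , t∈A′ , λ t≡a → Graph.irrefl G (sym t≡a) at))
      ... | inj₂ (inj₁ t∈L)               = p⊆p∪q ⁅ b ⁆ (p⊆p∪q ⁅ x ⁆ t∈L)
      ... | inj₂ (inj₂ (inj₁ (_ , refl))) = p⊆p∪q ⁅ b ⁆ (q⊆p∪q L ⁅ x ⁆ (x∈⁅x⁆ x))
      ... | inj₂ (inj₂ (inj₂ (_ , refl))) = q⊆p∪q (L ∪ ⁅ x ⁆) ⁅ b ⁆ (x∈⁅x⁆ b)

    <k⇒≤ : ∀ {m l} → m < k → k ≤ l + 1 → m ≤ l
    <k⇒≤ {m} {l} m<k k≤ = s≤s⁻¹ (≤-trans m<k (≤-trans k≤ (≤-reflexive (+-comm l 1))))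

    ∣S∣≤∣border-AA′∣ : ∣ S c ∣ ≤ ∣ border c c′ ∣
    ∣S∣≤∣border-AA′∣ = <k⇒≤ (∣S∣<k c) k≤∣border-AA′∣+1

    -- As x ∉ B′ and b ∉ B, neither ax nor ab leaves this corner, so if it were nonempty its border
    -- would have at least k > ∣S′∣ vertices. The opposite border has at least ∣S∣, against
    -- submodularity.
    BB′-empty : ∀ {r} → r ∈ B c → r ∉ B c′
    BB′-empty r∈B r∈B′ = <⇒≱
      (+-mono-≤-< ∣S∣≤∣border-AA′∣ (<-≤-trans (∣S∣<k c′)
        (separator-size (λ i → i ∈ B c × i ∈ B c′) (border (flip c) (flip c′)) closed
          (B⊆V c r∈B) (r∈B , r∈B′) (border∩corner (flip c) (flip c′) r∈B r∈B′)
          a∈V (λ (a∈B , _) → A∩B c (x∈A c) a∈B) (border∩B (flip c) (flip c′) (x∈A c)))))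
      (∣border∣-submodular c c′)
      where
      closed : ∀ {r t} → r ∈ B c × r ∈ B c′ → Adj G r t →
               (t ∈ B c × t ∈ B c′) ⊎ t ∈ border (flip c) (flip c′)
      closed (r∈B , r∈B′) rt with leave-corner (flip c) (flip c′) r∈B r∈B′ rt
      ... | inj₁ t∈                       = inj₁ t∈
      ... | inj₂ (inj₁ t∈)                = inj₂ t∈
      ... | inj₂ (inj₂ (inj₁ (refl , _))) = ⊥-elim (x∉B′ r∈B′)
      ... | inj₂ (inj₂ (inj₂ (refl , _))) = ⊥-elim (b∉B r∈B)

    ∣A-a∣<∣A∣ : ∣ A c - a ∣ < ∣ A c ∣
    ∣A-a∣<∣A∣ = x∈p⇒∣p-x∣<∣p∣ (x∈A c)

    -- The border of A ∩ A′ lies in S ∪ (A - a) and has at least ∣S∣ elements,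
    -- so at most ∣A - a∣ places are left for X.
    outside-border : (X : Subset n) → (∀ {i} → i ∈ X → i ∈ S c) →
                     (∀ {i} → i ∈ X → i ∉ border c c′) → ∣ X ∣ < ∣ A c ∣
    outside-border X X⊆S X∩L = ≤-<-trans (+-cancelˡ-≤ ∣ S c ∣ _ _ (begin
      ∣ S c ∣ + ∣ X ∣           ≤⟨ +-monoˡ-≤ ∣ X ∣ ∣S∣≤∣border-AA′∣ ⟩
      ∣ border c c′ ∣ + ∣ X ∣   ≤⟨ ∣p∣+∣q∣≤∣r∣+∣t∣ (border c c′) X (S c) (A c - a) L⊆ (inj₁ ∘ X⊆S)
                                   (λ i∈L i∈X → ⊥-elim (X∩L i∈X i∈L)) ⟩
      ∣ S c ∣ + ∣ A c - a ∣     ∎)) ∣A-a∣<∣A∣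
      where
      open ≤-Reasoning
      L⊆ : ∀ {i} → i ∈ border c c′ → i ∈ S c ⊎ i ∈ A c - a
      L⊆ i∈ with border⁻ c c′ i∈
      ... | inj₁ (i∈S′ , inj₁ i∈A) = inj₂ (x∈p∧x≢y⇒x∈p-y i∈A λ { refl → A∩S c′ (x∈A c′) i∈S′ })
      ... | inj₁ (_ , inj₂ i∈S)    = inj₁ i∈S
      ... | inj₂ (i∈S , _)         = inj₁ i∈S

    Smaller : Fin n → Fin n → Set
    Smaller p q = ∃ λ (d : Cut p q) → ∣ A d ∣ < ∣ A c ∣

    -- Both corners inside B′ other than S ∩ B′ are empty, so B′ lies in S and misses the border of
    -- A ∩ A′.
    AB′-empty⇒smaller : (∀ {r} → r ∈ A c → r ∉ B c′) → Smaller b a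
    AB′-empty⇒smaller AB′-empty = flip c′ , outside-border (B c′)
      (λ i∈B′ → case cover c (B⊆V c′ i∈B′) of λ where
        (inj₁ i∈A)        → ⊥-elim (AB′-empty i∈A i∈B′)
        (inj₂ (inj₁ i∈S)) → i∈S
        (inj₂ (inj₂ i∈B)) → ⊥-elim (BB′-empty i∈B i∈B′))
      (border∩B′ c c′)

    module _ {r} (r∈A : r ∈ A c) (r∈B′ : r ∈ B c′) where

      L : Subset n
      L = border c (flip c′)

      leave-AB′ : ∀ {r t} → r ∈ A c → r ∈ B c′ → Adj G r t →
                  (t ∈ A c × t ∈ B c′) ⊎ t ∈ L ⊎ (r ≡ b × t ≡ a)
      leave-AB′ r∈A r∈B′ rt with leave-corner c (flip c′) r∈A r∈B′ rt
      ... | inj₁ t∈                       = inj₁ t∈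
      ... | inj₂ (inj₁ t∈)                = inj₂ (inj₁ t∈)
      ... | inj₂ (inj₂ (inj₁ (refl , _))) = ⊥-elim (A∩B c′ (x∈A c′) r∈B′)
      ... | inj₂ (inj₂ (inj₂ eqs))        = inj₂ (inj₂ eqs)

      -- Only the edge ba can leave A ∩ B′ without meeting `L`, so `L` together with `a` separates
      -- `r` from `x`.
      k≤∣L∣+1 : k ≤ ∣ L ∣ + 1
      k≤∣L∣+1 = ≤-trans
        (separator-size (λ i → i ∈ A c × i ∈ B c′) (L ∪ ⁅ a ⁆)
          (λ (r∈A , r∈B′) rt → case leave-AB′ r∈A r∈B′ rt of λ where
            (inj₁ t∈)                → inj₁ t∈
            (inj₂ (inj₁ t∈))         → inj₂ (p⊆p∪q ⁅ a ⁆ t∈)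
            (inj₂ (inj₂ (_ , refl))) → inj₂ (q⊆p∪q L ⁅ a ⁆ (x∈⁅x⁆ a)))
          (A⊆V c r∈A) (r∈A , r∈B′)
          (∉border∪⁅⁆ L (border∩corner c (flip c′) r∈A r∈B′) λ { refl → A∩B c′ (x∈A c′) r∈B′ })
          (B⊆V c (y∈B c)) (λ (x∈A , _) → A∩B c x∈A (y∈B c))
          (∉border∪⁅⁆ L (border∩B c (flip c′) (y∈B c)) (a≢x ∘ sym)))
        (∣p∪⁅x⁆∣≤∣p∣+1 L a)

      -- Here `L` and B are disjoint subsets of S′ ∪ (S ∩ B′), and ∣L∣ is at least ∣S′∣. Hence ∣B∣ ≤
      -- ∣S ∩ B′∣, which `outside-border` bounds.
      BA′-empty⇒smaller : (∀ {r} → r ∈ B c → r ∉ A c′) → Smaller x a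
      BA′-empty⇒smaller BA′-empty = flip c , ≤-<-trans
        (+-cancelˡ-≤ ∣ S c′ ∣ _ _ (begin
          ∣ S c′ ∣ + ∣ B c ∣          ≤⟨ +-monoˡ-≤ ∣ B c ∣ (<k⇒≤ (∣S∣<k c′) k≤∣L∣+1) ⟩
          ∣ L ∣ + ∣ B c ∣             ≤⟨ ∣p∣+∣q∣≤∣r∣+∣t∣ L (B c) (S c′) (S c ∩ B c′) L⊆ B⊆
                                         (λ i∈L i∈B → ⊥-elim (border∩B c (flip c′) i∈B i∈L)) ⟩
          ∣ S c′ ∣ + ∣ S c ∩ B c′ ∣   ∎))
        (outside-border (S c ∩ B c′) (p∩q⊆p (S c) (B c′)) (border∩B′ c c′ ∘ p∩q⊆q (S c) (B c′)))
        where
        open ≤-Reasoning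
        L⊆ : ∀ {i} → i ∈ L → i ∈ S c′ ⊎ i ∈ S c ∩ B c′
        L⊆ i∈ with border⁻ c (flip c′) i∈
        ... | inj₁ (i∈S′ , _) = inj₁ i∈S′
        ... | inj₂ i∈         = inj₂ (x∈p∩q⁺ i∈)

        B⊆ : ∀ {i} → i ∈ B c → i ∈ S c′ ⊎ i ∈ S c ∩ B c′
        B⊆ i∈B with cover c′ (B⊆V c i∈B)
        ... | inj₁ i∈A′         = ⊥-elim (BA′-empty i∈B i∈A′)
        ... | inj₂ (inj₁ i∈S′)  = inj₁ i∈S′
        ... | inj₂ (inj₂ i∈B′)  = ⊥-elim (BB′-empty i∈B i∈B′)

      -- The borders of both mixed corners have at least k - 1 vertices, so submodularity leaves ∣L∣
      -- ≤ ∣S′∣ < k. Then `L` with the side A ∩ B′ is a cut of ba, and that side is a subset of A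
      -- missing `a`.
      BA′-nonempty⇒smaller : ∀ {s} → s ∈ B c → s ∈ A c′ → Smaller b a
      BA′-nonempty⇒smaller s∈B s∈A′ = mkCut (A c ∩ B c′) L
        (A⊆V c ∘ p∩q⊆p (A c) (B c′)) (x∈p∩q⁺ (b∈A , y∈B c′))
        a∈V (A∩B c′ (x∈A c′) ∘ p∩q⊆q (A c) (B c′)) (border∩B′ c (flip c′) (x∈A c′))
        (λ i∈ → let (i∈A , i∈B′) = x∈p∩q⁻ (A c) (B c′) i∈ in border∩corner c (flip c′) i∈A i∈B′)
        ∣L∣<k
        (λ p∈ pq → let (p∈A , p∈B′) = x∈p∩q⁻ (A c) (B c′) p∈ in case leave-AB′ p∈A p∈B′ pq of λ where
          (inj₁ q∈) → inj₁ (x∈p∩q⁺ q∈)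
          (inj₂ q)  → inj₂ q)
        , ≤-<-trans (p⊆q⇒∣p∣≤∣q∣ {q = A c - a} (λ i∈ → let (i∈A , i∈B′) = x∈p∩q⁻ (A c) (B c′) i∈ in
            x∈p∧x≢y⇒x∈p-y {p = A c} i∈A λ { refl → A∩B c′ (x∈A c′) i∈B′ })) ∣A-a∣<∣A∣
        where
        L′ = border (flip c) c′

        closed : ∀ {r t} → r ∈ B c × r ∈ A c′ → Adj G r t → (t ∈ B c × t ∈ A c′) ⊎ t ∈ L′ ∪ ⁅ a ⁆
        closed (r∈B , r∈A′) rt with leave-corner (flip c) c′ r∈B r∈A′ rt
        ... | inj₁ t∈                       = inj₁ t∈
        ... | inj₂ (inj₁ t∈)                = inj₂ (p⊆p∪q ⁅ a ⁆ t∈)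
        ... | inj₂ (inj₂ (inj₁ (_ , refl))) = inj₂ (q⊆p∪q L′ ⁅ a ⁆ (x∈⁅x⁆ a))
        ... | inj₂ (inj₂ (inj₂ (refl , _))) = ⊥-elim (A∩B c (x∈A c) r∈B)

        k≤∣L′∣+1 : k ≤ ∣ L′ ∣ + 1
        k≤∣L′∣+1 = ≤-trans
          (separator-size (λ i → i ∈ B c × i ∈ A c′) (L′ ∪ ⁅ a ⁆) closed
            (B⊆V c s∈B) (s∈B , s∈A′)
            (∉border∪⁅⁆ L′ (border∩corner (flip c) c′ s∈B s∈A′) λ { refl → A∩B c (x∈A c) s∈B })
            (B⊆V c′ (y∈B c′)) (λ (_ , b∈A′) → A∩B c′ b∈A′ (y∈B c′))
            (∉border∪⁅⁆ L′ (border∩B′ (flip c) c′ (y∈B c′)) (a≢b ∘ sym)))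
          (∣p∪⁅x⁆∣≤∣p∣+1 L′ a)

        ∣L∣<k : ∣ L ∣ < k
        ∣L∣<k = ≤-<-trans (+-cancelʳ-≤ ∣ S c ∣ _ _ (begin
          ∣ L ∣ + ∣ S c ∣     ≤⟨ +-monoʳ-≤ ∣ L ∣ (<k⇒≤ (∣S∣<k c) k≤∣L′∣+1) ⟩
          ∣ L ∣ + ∣ L′ ∣      ≤⟨ ∣border∣-submodular c (flip c′) ⟩
          ∣ S c ∣ + ∣ S c′ ∣  ≡⟨ +-comm ∣ S c ∣ ∣ S c′ ∣ ⟩
          ∣ S c′ ∣ + ∣ S c ∣  ∎)) (∣S∣<k c′)
          where open ≤-Reasoning

        -- Otherwise every edge leaving A ∩ B′ ends in `L`, and `L` is too small to separate.
        b∈A : b ∈ A c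
        b∈A = decidable-stable (b ∈? A c) λ b∉A → <⇒≱ ∣L∣<k
          (separator-size (λ i → i ∈ A c × i ∈ B c′) L
            (λ (r∈A , r∈B′) rt → case leave-AB′ r∈A r∈B′ rt of λ where
              (inj₁ t∈)                → inj₁ t∈
              (inj₂ (inj₁ t∈))         → inj₂ t∈
              (inj₂ (inj₂ (refl , _))) → ⊥-elim (b∉A r∈A))
            (A⊆V c r∈A) (r∈A , r∈B′) (border∩corner c (flip c′) r∈A r∈B′)
            (B⊆V c (y∈B c)) (λ (x∈A , _) → A∩B c x∈A (y∈B c))
            (border∩B c (flip c′) (y∈B c)))

    smaller : Smaller b a ⊎ Smaller x a
    smaller with any? (λ r → (r ∈? A c) ×-dec (r ∈? B c′)) | any? (λ r → (r ∈? B c) ×-dec (r ∈? A c′))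
    ... | no none | _ =
      inj₁ (AB′-empty⇒smaller λ r∈A r∈B′ → none (_ , r∈A , r∈B′))
    ... | yes (_ , r∈A , r∈B′) | no none =
      inj₂ (BA′-empty⇒smaller r∈A r∈B′ λ r∈B r∈A′ → none (_ , r∈B , r∈A′))
    ... | yes (_ , r∈A , r∈B′) | yes (_ , s∈B , s∈A′) =
      inj₁ (BA′-nonempty⇒smaller r∈A r∈B′ s∈B s∈A′)

  -- Minimum degree 2 is impossible where every edge has a cut.

  module Critical (U : Fin n → Set) (k<deg : ∀ {a} → U a → k + 1 ≤ degree G a)
    (cuts : ∀ {x y} → U x → U y → Adj G x y → Cut x y) where

    -- A neighbour in `Q` other than any prescribed `e` encodes minimum degree at least 2. Both
    -- outcomes of `Descent.smaller` are cuts of an edge inside `Q`, rooted at its other end, so the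
    -- descent on ∣A∣ can continue.
    no-two-neighbours : (Q : Fin n → Set) → (∀ {a} → Q a → U a) →
      (∀ {a} e → Q a → ∃[ d ] (Q d × d ≢ e × Adj G a d)) → ∀ {a} → ¬ Q a
    no-two-neighbours Q Q⊆U next {a} Qa =
      -- The excluded vertex `a` is a dummy: any neighbour starts the descent.
      let (_ , Qx , _ , ax) = next a Qa
          c = cuts (Q⊆U Qa) (Q⊆U Qx) ax
      in descend Qa Qx ax c (<-wellFounded _)
      where
      descend : ∀ {a x} → Q a → Q x → Adj G a x → (c : Cut a x) → Acc _<_ ∣ A c ∣ → ⊥
      descend {a} {x} Qa Qx ax c (acc rec) =
        let (b , Qb , b≢x , ab) = next x Qa
            c′ = cuts (Q⊆U Qa) (Q⊆U Qb) ab
        in case Descent.smaller c c′ b≢x ax ab (k<deg (Q⊆U Qa)) of λ where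
          (inj₁ (d , d<c)) → descend Qb Qa (Graph.sym G ab) d (rec d<c)
          (inj₂ (d , d<c)) → descend Qx Qa (Graph.sym G ax) d (rec d<c)

    -- The root `v` may have only one neighbour `q` in `Q`. In that case `v` is deleted and `q`
    -- becomes the root; the other vertices are not adjacent to `v`, so they lose nothing.
    no-two-neighbours-off-root : (Q : Subset n) → (∀ {a} → a ∈ Q → U a) →
      ∀ {v q} → v ∈ Q → q ∈ Q → Adj G v q →
      (∀ {a} e → a ∈ Q → a ≢ v → ∃[ d ] (d ∈ Q × d ≢ e × Adj G a d)) → ⊥
    no-two-neighbours-off-root Q Q⊆U = prune Q Q⊆U (<-wellFounded _)
      where
      prune : (Q : Subset n) → (∀ {a} → a ∈ Q → U a) → Acc _<_ ∣ Q ∣ →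
        ∀ {v q} → v ∈ Q → q ∈ Q → Adj G v q →
        (∀ {a} e → a ∈ Q → a ≢ v → ∃[ d ] (d ∈ Q × d ≢ e × Adj G a d)) → ⊥
      prune Q Q⊆U (acc rec) {v} {q} v∈Q q∈Q vq next
        with any? (λ b → (b ∈? Q) ×-dec (¬? (b ≟ q) ×-dec Graph.adj? G v b))
      ... | yes (b , b∈Q , b≢q , vb) = no-two-neighbours (_∈ Q) Q⊆U next′ v∈Q
        where
        next′ : ∀ {a} e → a ∈ Q → ∃[ d ] (d ∈ Q × d ≢ e × Adj G a d)
        next′ {a} e a∈Q with a ≟ v | q ≟ e
        ... | no a≢v   | _        = next e a∈Q a≢v
        ... | yes refl | yes refl = b , b∈Q , b≢q , vb
        ... | yes refl | no q≢e   = q , q∈Q , q≢e , vq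
      ... | no lonely =
        let q≢v = λ q≡v → Graph.irrefl G (sym q≡v) vq
            (d , d∈Q , d≢v , qd) = next v q∈Q q≢v
        in prune (Q - v) (Q⊆U ∘ p─q⊆p Q ⁅ v ⁆) (rec (x∈p⇒∣p-x∣<∣p∣ v∈Q))
             (x∈p∧x≢y⇒x∈p-y q∈Q q≢v) (x∈p∧x≢y⇒x∈p-y d∈Q d≢v) qd next′
        where
        next′ : ∀ {a} e → a ∈ Q - v → a ≢ q → ∃[ d ] (d ∈ Q - v × d ≢ e × Adj G a d)
        next′ {a} e a∈ a≢q =
          let a∈Q = p─q⊆p Q ⁅ v ⁆ a∈
              (d , d∈Q , d≢e , ad) = next e a∈Q λ { refl → x∈p─q⇒x∉q Q ⁅ v ⁆ a∈ (x∈⁅x⁆ v) }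
          in d , x∈p∧x≢y⇒x∈p-y d∈Q (λ d≡v → lonely (a , a∈Q , a≢q , subst (λ i → Adj G i a) d≡v (Graph.sym G ad)))
               , d≢e , ad

-- Every vertex of a cycle has two distinct neighbours on it.

module _ (H : Graph n) where

  last-adjacent : ∀ {x} z zs → Linked (Adj H) (z ∷ zs ∷ʳ x) → ∃[ y ] (y ∈ₗ z ∷ zs × Adj H y x)
  last-adjacent z []        (zx ∷ _)  = z , here refl , zx
  last-adjacent z (z′ ∷ zs) (_ ∷ zs⋯) = let (y , y∈ , yx) = last-adjacent z′ zs zs⋯ in y , there y∈ , yx

  -- The induction runs along the cycle, with `p` the predecessor of `ys` and `x` the closing
  -- vertex. Only at the start can `p` be `x`; the length condition then keeps the predecessor and
  -- successor distinct.
  inner-neighbours : ∀ {x} p ys → Unique (p ∷ ys) → x ∉ₗ ys → (p ≡ x → 2 ≤ length ys) →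
    Linked (Adj H) (p ∷ ys ∷ʳ x) → ∀ {a} → a ∈ₗ ys →
    ∃[ r ] ∃[ t ] (r ∈ₗ p ∷ ys × t ∈ₗ x ∷ ys × r ≢ t × Adj H a r × Adj H a t)
  inner-neighbours {x} p (y ∷ []) _ _ long (py ∷ yx ∷ _) (here refl) =
    p , x , here refl , here refl , (λ p≡x → <⇒≱ (s≤s z<s) (long p≡x)) , Graph.sym H py , yx
  inner-neighbours p (y ∷ y′ ∷ ys) ((_ ∷ p≢y′ ∷ _) ∷ _) _ _ (py ∷ yy′ ∷ _) (here refl) =
    p , y′ , here refl , there (there (here refl)) , p≢y′ , Graph.sym H py , yy′
  inner-neighbours p (y ∷ ys) (_ ∷ unique) x∉ _ (_ ∷ linked) (there a∈)
    with inner-neighbours y ys unique (x∉ ∘ there) (λ y≡x → ⊥-elim (x∉ (here (sym y≡x)))) linked a∈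
  ... | r , t , r∈ , here t≡x  , rest = r , t , there r∈ , here t≡x , rest
  ... | r , t , r∈ , there t∈ , rest = r , t , there r∈ , there (there t∈) , rest

  cycle-neighbours : ∀ {x vs} → IsCycle H x vs → ∀ {a} → a ∈ₗ x ∷ vs →
    ∃[ r ] ∃[ t ] (r ∈ₗ x ∷ vs × t ∈ₗ x ∷ vs × r ≢ t × Adj H a r × Adj H a t)
  cycle-neighbours {x} {y ∷ y′ ∷ ys} (_ , (_ ∷ y∉ ∷ _) , xy ∷ _ ∷ linked) (here refl) =
    let (z , z∈ , zx) = last-adjacent y′ ys linked
    in y , z , there (here refl) , there (there z∈) , All.lookup y∉ z∈ , xy , Graph.sym H zx
  cycle-neighbours {vs = vs} (long , unique@(x∉ ∷ _) , linked) (there a∈) =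
    inner-neighbours _ vs unique (λ x∈ → All.lookup x∉ x∈ refl) (λ _ → long) linked a∈
  cycle-neighbours {vs = _ ∷ []} (s≤s () , _) (here refl)

-- Structure of `G[U]` when none of its edges is removable.

module NoRemovable {n k : ℕ} (G : Graph n) (G-connected : k -Connected G) (W : Subset n)
  (deg : ∀ x → x ∈ V G ─ W → degree G x ≥ (k + 1) ⊔ ∣ W ∣)
  (cuts : ∀ x y → Adj (G [ V G ─ W ]) x y → KConnected.Cut G G-connected x y) where

  open KConnected G G-connected
  open Cut

  U : Subset n
  U = V G ─ W

  k<deg : ∀ {x} → x ∈ U → k + 1 ≤ degree G x
  k<deg x∈U = ≤-trans (m≤m⊔n (k + 1) ∣ W ∣) (deg _ x∈U)

  ∣W∣≤deg : ∀ {x} → x ∈ U → ∣ W ∣ ≤ degree G x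
  ∣W∣≤deg x∈U = ≤-trans (m≤n⊔m (k + 1) ∣ W ∣) (deg _ x∈U)

  ∈W⊎∈U : ∀ {x y} → Adj G x y → y ∈ W ⊎ y ∈ U
  ∈W⊎∈U {y = y} xy with y ∈? W
  ... | yes y∈W = inj₁ y∈W
  ... | no  y∉W = inj₂ (x∈p∧x∉q⇒x∈p─q (Graph.adj⇒∈V G (Graph.sym G xy)) y∉W)

  ∈U⇒∉W : ∀ {x} → x ∈ U → x ∉ W
  ∈U⇒∉W = x∈p─q⇒x∉q (V G) W

  open Critical (_∈ U) k<deg (λ x∈U y∈U xy → cuts _ _ (xy , x∈U , y∈U))

  forest : Forest (G [ U ])
  forest (x , vs , cycle) = no-two-neighbours (_∈ₗ x ∷ vs)
    (λ a∈ → let (_ , _ , _ , _ , _ , (_ , a∈U , _) , _) = cycle-neighbours (G [ U ]) cycle a∈ in a∈U)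
    next (here refl)
    where
    next : ∀ {a} e → a ∈ₗ x ∷ vs → ∃[ d ] (d ∈ₗ x ∷ vs × d ≢ e × Adj G a d)
    next e a∈ with cycle-neighbours (G [ U ]) cycle a∈
    ... | r , t , r∈ , t∈ , r≢t , (ar , _) , (at , _) with r ≟ e
    ... | no  r≢e  = r , r∈ , r≢e , ar
    ... | yes refl = t , t∈ , r≢t ∘ sym , at

  -- The neighbourhood of a leaf.

  module _ {u v} (uv : Adj (G [ U ]) u v) (only-v : ∀ {t} → Adj (G [ U ]) u t → t ≡ v) where

    private
      u∈U = proj₁ (proj₂ uv)
      v∈U = proj₂ (proj₂ uv)
      c = cuts u v uv
      Q = B c ∩ U
      WB = W ∩ B c

    -- All neighbours of `u` lie in W ∪ {v}, and `v` is the only one in B. So N(u) and W ∩ B are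
    -- disjoint.
    deg+∣W∩B∣≤∣W∣+1 : degree G u + ∣ WB ∣ ≤ ∣ W ∣ + 1
    deg+∣W∩B∣≤∣W∣+1 = ≤-trans
      (∣p∣+∣q∣≤∣r∣+∣t∣ (N G u) WB W ⁅ v ⁆
        (λ t∈N → let ut = ∈N⁻ G t∈N in case ∈W⊎∈U ut of λ where
          (inj₁ t∈W) → inj₁ t∈W
          (inj₂ t∈U) → inj₂ (subst (_∈ ⁅ v ⁆) (sym (only-v (ut , u∈U , t∈U))) (x∈⁅x⁆ v)))
        (inj₁ ∘ p∩q⊆p W (B c))
        (λ t∈N t∈WB → let (t∈W , t∈B) = x∈p∩q⁻ W (B c) t∈WB in
          case proj₂ (cross c (x∈A c) t∈B (∈N⁻ G t∈N)) of λ { refl → ⊥-elim (∈U⇒∉W v∈U t∈W) }))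
      (≤-reflexive (cong (∣ W ∣ +_) (∣⁅x⁆∣≡1 v)))

    Tight : Set
    Tight = ∣ W ∣ ≡ k + 1 × degree G u ≤ ∣ W ∣

    -- From d(b) ≥ k + 1 some vertex lies in W ∩ B, whence d(u) ≤ ∣W∣; from d(u) ≥ ∣W∣ there is at
    -- most one, whence ∣W∣ ≤ d(b) ≤ k + 1.
    small-degree⇒tight : ∀ {b} → b ∈ U → degree G b ≤ k + ∣ WB ∣ → Tight
    small-degree⇒tight {b} b∈U small = ≤-antisym ∣W∣≤k+1 (≤-trans (k<deg u∈U) deg≤∣W∣) , deg≤∣W∣
      where
      open ≤-Reasoning
      1≤∣WB∣ : 1 ≤ ∣ WB ∣
      1≤∣WB∣ = +-cancelˡ-≤ k _ _ (≤-trans (k<deg b∈U) small)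

      deg≤∣W∣ : degree G u ≤ ∣ W ∣
      deg≤∣W∣ = +-cancelʳ-≤ 1 _ _ (≤-trans (+-monoʳ-≤ (degree G u) 1≤∣WB∣) deg+∣W∩B∣≤∣W∣+1)

      ∣WB∣≤1 : ∣ WB ∣ ≤ 1
      ∣WB∣≤1 = +-cancelˡ-≤ ∣ W ∣ _ _ (≤-trans (+-monoˡ-≤ ∣ WB ∣ (∣W∣≤deg u∈U)) deg+∣W∩B∣≤∣W∣+1)

      ∣W∣≤k+1 : ∣ W ∣ ≤ k + 1
      ∣W∣≤k+1 = ≤-trans (∣W∣≤deg b∈U) (≤-trans small (+-monoʳ-≤ k ∣WB∣≤1))

    -- Apart from `e`, all neighbours of `b` lie in S or in W ∩ B; as ∣S∣ ≤ k - 1, counting `e` as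
    -- well gives exactly k.
    degree-bound : ∀ {b} e → (∀ {t} → Adj G b t → t ∈ Q → t ≡ e) →
                   (∀ {t} → Adj G b t → t ∈ A c → t ≡ e) → degree G b ≤ k + ∣ WB ∣
    degree-bound {b} e Q-case A-case = begin
      degree G b                         ≤⟨ p⊆q⇒∣p∣≤∣q∣ (N⊆ ∘ ∈N⁻ G) ⟩
      ∣ (S c ∪ WB) ∪ ⁅ e ⁆ ∣             ≤⟨ ∣p∪⁅x⁆∣≤∣p∣+1 (S c ∪ WB) e ⟩
      ∣ S c ∪ WB ∣ + 1                   ≤⟨ +-monoˡ-≤ 1 (∣p∪q∣≤∣p∣+∣q∣ (S c) WB) ⟩
      ∣ S c ∣ + ∣ WB ∣ + 1               ≡⟨ +-comm _ 1 ⟩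
      suc ∣ S c ∣ + ∣ WB ∣               ≤⟨ +-monoˡ-≤ ∣ WB ∣ (∣S∣<k c) ⟩
      k + ∣ WB ∣                         ∎
      where
      open ≤-Reasoning
      is-e : ∀ {t} → t ≡ e → t ∈ (S c ∪ WB) ∪ ⁅ e ⁆
      is-e refl = q⊆p∪q (S c ∪ WB) ⁅ e ⁆ (x∈⁅x⁆ e)

      N⊆ : ∀ {t} → Adj G b t → t ∈ (S c ∪ WB) ∪ ⁅ e ⁆
      N⊆ bt with cover c (Graph.adj⇒∈V G (Graph.sym G bt)) | ∈W⊎∈U bt
      ... | inj₁ t∈A        | _        = is-e (A-case bt t∈A)
      ... | inj₂ (inj₁ t∈S) | _        = p⊆p∪q ⁅ e ⁆ (p⊆p∪q WB t∈S)
      ... | inj₂ (inj₂ t∈B) | inj₁ t∈W = p⊆p∪q ⁅ e ⁆ (q⊆p∪q (S c) WB (x∈p∩q⁺ (t∈W , t∈B)))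
      ... | inj₂ (inj₂ t∈B) | inj₂ t∈U = is-e (Q-case bt (x∈p∩q⁺ (t∈B , t∈U)))

    leaf-tight : Tight
    leaf-tight = decidable-stable ((∣ W ∣ ≟ℕ k + 1) ×-dec (degree G u ≤? ∣ W ∣)) λ ¬tight →
      let
        v-next : ∃[ q ] (q ∈ Q × Adj G v q)
        v-next = decidable-stable (any? λ q → (q ∈? Q) ×-dec Graph.adj? G v q) λ none →
          -- The only neighbour of `v` on the A side is `u`, so `u` is the one exception allowed in
          -- the degree bound.
          ¬tight (small-degree⇒tight v∈U (degree-bound u
            (λ vt t∈Q → ⊥-elim (none (_ , t∈Q , vt)))
            (λ vt t∈A → proj₁ (cross c t∈A (y∈B c) (Graph.sym G vt)))))

        next : ∀ {b} e → b ∈ Q → b ≢ v → ∃[ d ] (d ∈ Q × d ≢ e × Adj G b d)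
        next {b} e b∈Q b≢v =
          let (b∈B , b∈U) = x∈p∩q⁻ (B c) U b∈Q in
          decidable-stable (any? λ d → (d ∈? Q) ×-dec (¬? (d ≟ e) ×-dec Graph.adj? G b d)) λ none →
          -- As b ≠ v, no edge joins `b` to A, so the allowed exception can be spent on a neighbour
          -- in `Q`.
          ¬tight (small-degree⇒tight b∈U (degree-bound e
            (λ {t} bt t∈Q → decidable-stable (t ≟ e) λ t≢e → none (t , t∈Q , t≢e , bt))
            (λ bt t∈A → ⊥-elim (b≢v (proj₂ (cross c t∈A b∈B (Graph.sym G bt)))))))

        (_ , q∈Q , vq) = v-next
      in no-two-neighbours-off-root Q (p∩q⊆q (B c) U) (x∈p∩q⁺ (y∈B c , v∈U)) q∈Q vq next

    -- Since `v` is a neighbour outside W and d(u) ≤ ∣W∣, some vertex of W is missed. Missing two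
    -- would leave d(u) < ∣W∣.
    leaf-neighbours : ∃[ z ] (z ∈ W × N G u ≡ (W - z) ∪ ⁅ v ⁆)
    leaf-neighbours with any? (λ z → (z ∈? W) ×-dec ¬? (Graph.adj? G u z))
    ... | no all = ⊥-elim (<⇒≱ (x∈p⇒∣p-x∣<∣p∣ (∈N⁺ G (proj₁ uv)))
      (≤-trans (proj₂ leaf-tight) (p⊆q⇒∣p∣≤∣q∣ {q = N G u - v} λ {y} y∈W →
        x∈p∧x≢y⇒x∈p-y {p = N G u}
        (∈N⁺ G (decidable-stable (Graph.adj? G u y) λ ¬uy → all (y , y∈W , ¬uy)))
        (λ { refl → ∈U⇒∉W v∈U y∈W }))))
    ... | yes (z , z∈W , ¬uz) = z , z∈W , ⊆-antisym (N⊆ ∘ ∈N⁻ G) ⊆N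
      where
      open ≤-Reasoning
      is-v : ∀ {t} (p : Subset n) → t ≡ v → t ∈ p ∪ ⁅ v ⁆
      is-v p refl = q⊆p∪q p ⁅ v ⁆ (x∈⁅x⁆ v)

      N⊆ : ∀ {t} → Adj G u t → t ∈ (W - z) ∪ ⁅ v ⁆
      N⊆ ut with ∈W⊎∈U ut
      ... | inj₁ t∈W = p⊆p∪q ⁅ v ⁆ (x∈p∧x≢y⇒x∈p-y t∈W λ { refl → ¬uz ut })
      ... | inj₂ t∈U = is-v (W - z) (only-v (ut , u∈U , t∈U))

      only-z : ∀ {y} → y ∈ W - z → ¬ ¬ Adj G u y
      only-z {y} y∈ ¬uy = <-irrefl refl (begin-strict
        degree G u                ≤⟨ p⊆q⇒∣p∣≤∣q∣ (N⊆′ ∘ ∈N⁻ G) ⟩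
        ∣ (W - z - y) ∪ ⁅ v ⁆ ∣   ≤⟨ ∣p∪⁅x⁆∣≤∣p∣+1 (W - z - y) v ⟩
        ∣ W - z - y ∣ + 1         ≡⟨ +-comm _ 1 ⟩
        suc ∣ W - z - y ∣         ≤⟨ x∈p⇒∣p-x∣<∣p∣ y∈ ⟩
        ∣ W - z ∣                 <⟨ x∈p⇒∣p-x∣<∣p∣ z∈W ⟩
        ∣ W ∣                     ≤⟨ ∣W∣≤deg u∈U ⟩
        degree G u                ∎)
        where
        N⊆′ : ∀ {t} → Adj G u t → t ∈ (W - z - y) ∪ ⁅ v ⁆
        N⊆′ ut with x∈p∪q⁻ (W - z) ⁅ v ⁆ (N⊆ ut)
        ... | inj₁ t∈ = p⊆p∪q ⁅ v ⁆ (x∈p∧x≢y⇒x∈p-y t∈ λ { refl → ¬uy ut })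
        ... | inj₂ t∈ = is-v (W - z - y) (x∈⁅y⁆⇒x≡y v t∈)

      ⊆N : (W - z) ∪ ⁅ v ⁆ ⊆ N G u
      ⊆N t∈ with x∈p∪q⁻ (W - z) ⁅ v ⁆ t∈
      ... | inj₁ t∈W-z = ∈N⁺ G (decidable-stable (Graph.adj? G u _) (only-z t∈W-z))
      ... | inj₂ t∈⁅v⁆ with refl ← x∈⁅y⁆⇒x≡y v t∈⁅v⁆ = ∈N⁺ G (proj₁ uv)

  -- If the equality failed, no vertex of `G[U]` could be a leaf, so the non-isolated vertices of
  -- `G[U]` would induce minimum degree at least 2.
  ∣W∣≡k+1 : ∃[ x ] ∃[ y ] Adj (G [ U ]) x y → ∣ W ∣ ≡ k + 1
  ∣W∣≡k+1 (_ , edge) = decidable-stable (∣ W ∣ ≟ℕ k + 1) λ ∣W∣≢k+1 →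
    no-two-neighbours (λ a → ∃[ d ] Adj (G [ U ]) a d) (λ (_ , _ , a∈U , _) → a∈U)
      (λ {a} e (d , ad) →
        let (f , f≢e , (af , a∈U , f∈U)) =
              decidable-stable (any? λ f → ¬? (f ≟ e) ×-dec Graph.adj? (G [ U ]) a f) λ none →
                let only-e = λ {t} at → decidable-stable (t ≟ e) λ t≢e → none (t , t≢e , at)
                in ∣W∣≢k+1 (proj₁ (leaf-tight ad λ at → trans (only-e at) (sym (only-e ad))))
        in f , (a , Graph.sym G af , f∈U , a∈U) , f≢e , af)
      edge

  exceptional : ∃[ x ] ∃[ y ] Adj (G [ U ]) x y → Exceptional k G W
  exceptional edge = ∣W∣≡k+1 edge , forest , leaf
    where
    leaf : ∀ u → Leaf (G [ U ]) u →
      ∃[ z ] ∃[ v ] (z ∈ W × N (G [ U ]) u ≡ ⁅ v ⁆ × N G u ≡ (W - z) ∪ ⁅ v ⁆)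
    leaf u (_ , deg≡1) =
      let (v , N≡⁅v⁆) = ∣p∣≡1⇒p≡⁅x⁆ (N (G [ U ]) u) deg≡1
          (z , z∈W , N≡) = leaf-neighbours
            (∈N⁻ (G [ U ]) (subst (v ∈_) (sym N≡⁅v⁆) (x∈⁅x⁆ v)))
            (λ ut → x∈⁅y⁆⇒x≡y v (subst (_ ∈_) N≡⁅v⁆ (∈N⁺ (G [ U ]) ut)))
      in z , v , z∈W , N≡⁅v⁆ , N≡

-- The dichotomy: a removable edge, or a cut at every edge of `G[U]`.

theorem2p2 : ∀ {n} (k : ℕ) → 0 < k → (G : Graph n) → k -Connected G →
    (W : Subset n) → W ⊆ V G →
    let U = V G ─ W in
    (∃[ x ] ∃[ y ] Adj (G [ U ]) x y) →
    (∀ x → x ∈ U → degree G x ≥ (k + 1) ⊔ ∣ W ∣) →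
    (∃[ x ] ∃[ y ] (Adj (G [ U ]) x y × Removable k G x y)) ⊎ Exceptional k G W
theorem2p2 k _ G G-connected W _ edge deg =
  [ (λ cuts → inj₂ (NoRemovable.exceptional G G-connected W deg cuts edge)) , inj₁ ]′
    (∀⊎∃-Fin λ x → ∀⊎∃-Fin λ y → removable⊎cut-in-U x y)
  where
  open KConnected G G-connected
  U = V G ─ W

  removable⊎cut-in-U : ∀ x y →
    (Adj (G [ U ]) x y → Cut x y) ⊎ (Adj (G [ U ]) x y × Removable k G x y)
  removable⊎cut-in-U x y with Graph.adj? (G [ U ]) x y
  ... | no ¬xy = inj₁ λ xy → ⊥-elim (¬xy xy)
  ... | yes xy with removable⊎cut (proj₁ xy)
  ... | inj₁ removable = inj₂ (xy , removable)
  ... | inj₂ cut       = inj₁ λ _ → cut
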